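{- Let $D$ be a continuous dcpo. (i) If $y$ is a sharp element of $D$, then $\lnot(x\not\sqsubseteq^{+}y)$ implies $x\sqsubseteq y$ for every $x\in D$. In particular, the intrinsic apartness $\#$ on $D$ is tight on sharp elements: for all sharp $x,y\in D$, if $\lnot(x\mathrel{\#}y)$ then $x=y$. (ii) The intrinsic apartness on $D$ is cotransitive with respect to sharp elements in the following sense: for every $x,y\in D$ and every sharp element $z\in D$, if $x\mathrel{\#}y$, then $x\mathrel{\#}z$ or $y\mathrel{\#}z$.
   Context: Everything is constructive: neither excluded middle nor choice is assumed. A subset $S$ of a poset is directed if it is inhabited and any two elements of $S$ have an upper bound in $S$. A dcpo is a poset $(D,\sqsubseteq)$ in which every directed subset $S$ has a supremum $\bigsqcup S$. Write $x\ll y$ ($x$ is way below $y$) if for every directed $S$ with $y\sqsubseteq\bigsqcup S$ there is $s\in S$ with $x\sqsubseteq s$. $D$ is continuous if for every $x$ the set $\{y\in D\mid y\ll x\}$ is directed with supremum $x$. A subset $U\subseteq D$ is Scott open if it is an upper set and whenever $\bigsqcup S\in U$ with $S$ directed, some $s\in S$ is in $U$. Write $x\not\sqsubseteq^{+}y$ if there is a Scott open set containing $x$ but not $y$. The intrinsic apartness is $x\mathrel{\#}y\iff(x\not\sqsubseteq^{+}y)\vee(y\not\sqsubseteq^{+}x)$. An element $x\in D$ is sharp if for every $y,z\in D$ with $y\ll z$ we have $y\ll x$ or $\lnot(z\sqsubseteq x)$. -}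

module Defs where

open import Data.Product using (∃-syntax; _×_)
open import Data.Sum using (_⊎_)
open import Function.Bundles using (_⇔_)
open import Level using (Level; suc; _⊔_)
open import Relation.Binary.Bundles using (Poset)
open import Relation.Binary.Core using (Rel)
open import Relation.Nullary using (¬_)
open import Relation.Unary using (Pred; _∈_; _∉_; Satisfiable)

private
  variable
    ℓ p : Level

-- The types in Set ℓ play the role of sets and of truth values, so the subsets
-- of a poset P : Poset ℓ ℓ ℓ are the predicates in Pred Carrier ℓ.  They are not
-- required to respect _≈_: closing a subset under _≈_ changes neither its
-- directedness nor its upper bounds, and upper sets respect _≈_ anyway.

module _ (P : Poset ℓ ℓ ℓ) where
  open Poset P using (Carrier) renaming (_≤_ to _⊑_)

  Directed : Pred Carrier p → Set (ℓ ⊔ p)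
  Directed S =
    Satisfiable S ×
    (∀ x y → x ∈ S → y ∈ S → ∃[ z ] (z ∈ S × x ⊑ z × y ⊑ z))

  IsSupremum : Pred Carrier p → Carrier → Set (ℓ ⊔ p)
  IsSupremum S x =
    (∀ s → s ∈ S → s ⊑ x) ×
    (∀ u → (∀ s → s ∈ S → s ⊑ u) → x ⊑ u)

record DCPO (ℓ : Level) : Set (suc ℓ) where
  field
    poset : Poset ℓ ℓ ℓ

  open Poset poset public using (Carrier; _≈_) renaming (_≤_ to _⊑_)

  field
    ⨆            : (S : Pred Carrier ℓ) → Directed poset S → Carrier
    ⨆-isSupremum : ∀ S (δ : Directed poset S) → IsSupremum poset S (⨆ S δ)

module DomainTheory (D : DCPO ℓ) where
  open DCPO D public

  infix 4 _≪_ _⋢⁺_ _#_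

  _≪_ : Rel Carrier (suc ℓ)
  x ≪ y = ∀ S (δ : Directed poset S) → y ⊑ ⨆ S δ → ∃[ s ] (s ∈ S × x ⊑ s)

  -- The type y ≪ x quantifies over all subsets and hence lives in Set (suc ℓ).
  -- In an impredicative metatheory { y ∣ y ≪ x } is a subset regardless; here
  -- ↡ x is that subset, and ∈↡⇔≪ says that it has the required elements.
  record IsContinuous : Set (suc ℓ) where
    field
      ↡            : Carrier → Pred Carrier ℓ
      ∈↡⇔≪         : ∀ x y → y ∈ ↡ x ⇔ y ≪ x
      ↡-directed   : ∀ x → Directed poset (↡ x)
      ↡-isSupremum : ∀ x → IsSupremum poset (↡ x) x

  IsUpperSet : Pred Carrier ℓ → Set ℓ
  IsUpperSet U = ∀ x y → x ∈ U → x ⊑ y → y ∈ U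

  IsScottOpen : Pred Carrier ℓ → Set (suc ℓ)
  IsScottOpen U =
    IsUpperSet U ×
    (∀ S (δ : Directed poset S) → ⨆ S δ ∈ U → ∃[ s ] (s ∈ S × s ∈ U))

  _⋢⁺_ : Rel Carrier (suc ℓ)
  x ⋢⁺ y = ∃[ U ] (IsScottOpen U × x ∈ U × y ∉ U)

  _#_ : Rel Carrier (suc ℓ)
  x # y = (x ⋢⁺ y) ⊎ (y ⋢⁺ x)

  IsSharp : Pred Carrier (suc ℓ)
  IsSharp x = ∀ y z → y ≪ z → (y ≪ x) ⊎ (¬ (z ⊑ x))

{-# OPTIONS --safe #-}
-- By interpolation the sets ↟ v = { w ∣ v ≪ w } are Scott open.  If u ≪ v ≪ x and
-- y is sharp, then either u ≪ y, or v ⋢ y and ↟ v witnesses x ⋢⁺ y.  Part (i)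
-- applies this to every u ≪ x; part (ii) to some u ≪ x in the Scott open set
-- that separates x from y.
module Submission where

open import Defs
open import Data.Product using (_×_; _,_; proj₁; proj₂; ∃-syntax)
open import Data.Sum using (_⊎_; inj₁; inj₂; map₁; map₂; swap)
open import Function.Base using (_∘_)
open import Function.Bundles using (module Equivalence)
open import Level using (Level)
open import Relation.Binary.Bundles using (Poset)
open import Relation.Nullary using (¬_; contradiction)
open import Relation.Unary using (Pred; _∈_)

module _ {ℓ : Level} (D : DCPO ℓ) where
  open DomainTheory D
  open Poset poset using (refl; trans; antisym)

  ⊑-≪-trans : ∀ {x y z} → x ⊑ y → y ≪ z → x ≪ z
  ⊑-≪-trans x⊑y y≪z S δ z⊑⨆ with y≪z S δ z⊑⨆
  ... | s , s∈S , y⊑s = s , s∈S , trans x⊑y y⊑s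

  ≪-⊑-trans : ∀ {x y z} → x ≪ y → y ⊑ z → x ≪ z
  ≪-⊑-trans x≪y y⊑z S δ z⊑⨆ = x≪y S δ (trans y⊑z z⊑⨆)

  module _ (continuous : IsContinuous) where
    open IsContinuous continuous

    ∈↡⇒≪ : ∀ {x y} → y ∈ ↡ x → y ≪ x
    ∈↡⇒≪ {x} {y} = Equivalence.to (∈↡⇔≪ x y)

    ≪⇒∈↡ : ∀ {x y} → y ≪ x → y ∈ ↡ x
    ≪⇒∈↡ {x} {y} = Equivalence.from (∈↡⇔≪ x y)

    ≪⇒⊑ : ∀ {x y} → x ≪ y → x ⊑ y
    ≪⇒⊑ {x} {y} x≪y = proj₁ (↡-isSupremum y) x (≪⇒∈↡ x≪y)

    -- `⨆` picks one supremum, whereas continuity says that `x` is a supremum of `↡ x`; leastness of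
    -- `x` compares the two.
    ⊑⨆↡ : ∀ x → x ⊑ ⨆ (↡ x) (↡-directed x)
    ⊑⨆↡ x = proj₂ (↡-isSupremum x) _ (proj₁ (⨆-isSupremum (↡ x) (↡-directed x)))

    ↡↡ : Carrier → Pred Carrier ℓ
    ↡↡ x w = ∃[ v ] (v ∈ ↡ x × w ∈ ↡ v)

    ↡↡-directed : ∀ x → Directed poset (↡↡ x)
    ↡↡-directed x = inhabited , bounded
      where
      inhabited : ∃[ w ] (w ∈ ↡↡ x)
      inhabited with proj₁ (↡-directed x)
      ... | v , v∈ with proj₁ (↡-directed v)
      ... | w , w∈ = w , v , v∈ , w∈

      bounded : ∀ a b → a ∈ ↡↡ x → b ∈ ↡↡ x → ∃[ c ] (c ∈ ↡↡ x × a ⊑ c × b ⊑ c)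
      -- An upper bound `t` of `v` and `v′` in `↡ x` has both `a` and `b` way below it, so
      -- directedness of `↡ t` supplies `c`.
      bounded a b (v , v∈ , a∈) (v′ , v′∈ , b∈)
        with proj₂ (↡-directed x) v v′ v∈ v′∈
      ... | t , t∈ , v⊑t , v′⊑t
        with proj₂ (↡-directed t) a b
               (≪⇒∈↡ (≪-⊑-trans (∈↡⇒≪ a∈) v⊑t))
               (≪⇒∈↡ (≪-⊑-trans (∈↡⇒≪ b∈) v′⊑t))
      ... | c , c∈ , a⊑c , b⊑c = c , (t , t∈ , c∈) , a⊑c , b⊑c

    -- Suprema are taken twice: a bound of `↡↡ x` bounds each `↡ v` with `v ∈ ↡ x`, hence each such
    -- `v`, hence `x`.
    ⊑⨆↡↡ : ∀ x → x ⊑ ⨆ (↡↡ x) (↡↡-directed x)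
    ⊑⨆↡↡ x = proj₂ (↡-isSupremum x) _ λ v v∈ →
      proj₂ (↡-isSupremum v) _ λ w w∈ →
      proj₁ (⨆-isSupremum (↡↡ x) (↡↡-directed x)) w (v , v∈ , w∈)

    -- Testing `u ≪ x` on the directed set `↡↡ x` yields `u ⊑ w ≪ v ≪ x`.
    ≪-interpolation : ∀ {u x} → u ≪ x → ∃[ v ] (u ≪ v × v ≪ x)
    ≪-interpolation {u} {x} u≪x with u≪x (↡↡ x) (↡↡-directed x) (⊑⨆↡↡ x)
    ... | w , (v , v∈ , w∈) , u⊑w = v , ⊑-≪-trans u⊑w (∈↡⇒≪ w∈) , ∈↡⇒≪ v∈

    -- Membership goes through ↡ because v ≪ w lives one universe too high.
    ↟ : Carrier → Pred Carrier ℓ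
    ↟ v w = v ∈ ↡ w

    ↟-isScottOpen : ∀ v → IsScottOpen (↟ v)
    ↟-isScottOpen v = upper , inaccessible
      where
      upper : IsUpperSet (↟ v)
      upper x y v∈↡x x⊑y = ≪⇒∈↡ (≪-⊑-trans (∈↡⇒≪ v∈↡x) x⊑y)

      inaccessible : ∀ S (δ : Directed poset S) → ⨆ S δ ∈ ↟ v → ∃[ s ] (s ∈ S × s ∈ ↟ v)
      -- Applying `v ≪ ⨆ S δ` directly would give only `v ⊑ s`; interpolating first gives
      -- `v ≪ v′ ⊑ s`.
      inaccessible S δ v∈ with ≪-interpolation (∈↡⇒≪ v∈)
      ... | v′ , v≪v′ , v′≪⨆ with v′≪⨆ S δ refl
      ... | s , s∈S , v′⊑s = s , s∈S , ≪⇒∈↡ (≪-⊑-trans v≪v′ v′⊑s)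

    ≪∧⋢⇒⋢⁺ : ∀ {v x y} → v ≪ x → ¬ (v ⊑ y) → x ⋢⁺ y
    ≪∧⋢⇒⋢⁺ {v} v≪x v⋢y = ↟ v , ↟-isScottOpen v , ≪⇒∈↡ v≪x , v⋢y ∘ ≪⇒⊑ ∘ ∈↡⇒≪

    -- Sharpness is tested on `u ≪ v` rather than on `u ≪ x`: the element refuted to lie below `y`
    -- must itself be way below `x` for `↟ v` to contain `x`.
    sharp-located : ∀ {u x y} → IsSharp y → u ≪ x → (u ≪ y) ⊎ (x ⋢⁺ y)
    sharp-located y-sharp u≪x with ≪-interpolation u≪x
    ... | v , u≪v , v≪x = map₂ (≪∧⋢⇒⋢⁺ v≪x) (y-sharp _ v u≪v)

    sharp⇒¬⋢⁺⇒⊑ : ∀ {x y} → IsSharp y → ¬ (x ⋢⁺ y) → x ⊑ y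
    sharp⇒¬⋢⁺⇒⊑ {x} {y} y-sharp ¬x⋢⁺y = proj₂ (↡-isSupremum x) y below
      where
      below : ∀ u → u ∈ ↡ x → u ⊑ y
      below u u∈ with sharp-located y-sharp (∈↡⇒≪ u∈)
      ... | inj₁ u≪y  = ≪⇒⊑ u≪y
      ... | inj₂ x⋢⁺y = contradiction x⋢⁺y ¬x⋢⁺y

    #-tight : ∀ {x y} → IsSharp x → IsSharp y → ¬ (x # y) → x ≈ y
    #-tight x-sharp y-sharp ¬x#y =
      antisym (sharp⇒¬⋢⁺⇒⊑ y-sharp (¬x#y ∘ inj₁)) (sharp⇒¬⋢⁺⇒⊑ x-sharp (¬x#y ∘ inj₂))

    -- The open set `U` separating `x` from `y` contains some `u ≪ x`. If `u ≪ z`, the same `U`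
    -- separates `z` from `y`.
    ⋢⁺-cotransitive : ∀ {x y z} → IsSharp z → x ⋢⁺ y → (z ⋢⁺ y) ⊎ (x ⋢⁺ z)
    ⋢⁺-cotransitive {x} {y} {z} z-sharp (U , open-U@(upper , inaccessible) , x∈U , y∉U)
      with inaccessible (↡ x) (↡-directed x) (upper _ _ x∈U (⊑⨆↡ x))
    ... | u , u∈↡x , u∈U = map₁ separate (sharp-located z-sharp (∈↡⇒≪ u∈↡x))
      where
      separate : u ≪ z → z ⋢⁺ y
      separate u≪z = U , open-U , upper u z u∈U (≪⇒⊑ u≪z) , y∉U

    #-cotransitive : ∀ {x y z} → IsSharp z → x # y → (x # z) ⊎ (y # z)
    #-cotransitive z-sharp (inj₁ x⋢⁺y) with ⋢⁺-cotransitive z-sharp x⋢⁺y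
    ... | inj₁ z⋢⁺y = inj₂ (inj₂ z⋢⁺y)
    ... | inj₂ x⋢⁺z = inj₁ (inj₁ x⋢⁺z)
    -- With `x` and `y` exchanged this is the `inj₁` case, whose two outcomes `swap` puts back in
    -- order.
    #-cotransitive z-sharp (inj₂ y⋢⁺x) = swap (#-cotransitive z-sharp (inj₁ y⋢⁺x))

theorem5p15 : ∀ {ℓ : Level} (D : DCPO ℓ) →
    let open DomainTheory D in
    IsContinuous →
    ((∀ y → IsSharp y → ∀ x → ¬ (x ⋢⁺ y) → x ⊑ y) ×
    (∀ x y → IsSharp x → IsSharp y → ¬ (x # y) → x ≈ y)) ×
    (∀ x y z → IsSharp z → x # y → (x # z) ⊎ (y # z))
theorem5p15 D continuous =
  ( (λ y y-sharp x → sharp⇒¬⋢⁺⇒⊑ D continuous y-sharp)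
  , (λ x y → #-tight D continuous)) ,
  (λ x y z → #-cotransitive D continuous)
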